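{- Let $k$ be an odd positive integer and let $n$ be a positive integer that is a multiple of $k$. Then $$\left(\frac{n}{k}-1\right)!\;\leq\; M(n,k)\;\leq\; 3^n\,(n/k)!,$$ where $M(n,k)$ is the maximum size of a family of Hamilton paths in the complete graph $K_n$ such that for any two distinct members of the family there is a subpath with $k$ edges (on $k+1$ vertices) of one of the two Hamilton paths that is edge-disjoint from the whole of the other Hamilton path.
   Context: $K_n$ is the complete graph with vertex set $[n]=\{1,\dots,n\}$. Hamilton paths are undirected: a Hamilton path in $K_n$ is a subgraph that is a path visiting all $n$ vertices, identified with its edge set when $n\geq 2$ (so a vertex ordering and its reversal give the same Hamilton path; for $n=1$ there is exactly one, the single-vertex path). A subpath with $k$ edges of a Hamilton path consists of $k$ consecutive edges of it. -}

module Defs where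

open import Data.Fin.Base using (Fin; toℕ)
open import Data.Fin.Permutation using (Permutation′; _⟨$⟩ʳ_)
open import Data.Nat.Base using (ℕ; suc; _+_; _≤_; _<_)
open import Data.Product.Base using (∃; ∃₂; _×_)
open import Data.Sum.Base using (_⊎_)
open import Function.Definitions using (Injective)
open import Level using (0ℓ)
open import Relation.Binary.Core using (Rel; _⇔_)
open import Relation.Binary.PropositionalEquality.Core using (_≡_; _≢_)
open import Relation.Nullary.Negation.Core using (¬_)

-- A Hamilton path is presented by a vertex ordering P, where P ⟨$⟩ʳ i is the
-- i-th vertex visited.  Two orderings present the same Hamilton path when they
-- are related by _≈_ below: an ordering and its reversal are identified.
HamiltonPath : ℕ → Set
HamiltonPath n = Permutation′ n

private
  variable
    n : ℕ

-- EdgeAt P t u v: the undirected edge uv joins the vertices of P in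
-- positions t and t + 1 (positions are counted from 0).
EdgeAt : HamiltonPath n → ℕ → Rel (Fin n) 0ℓ
EdgeAt P t u v = ∃₂ λ i j → toℕ i ≡ t × toℕ j ≡ suc t ×
  ((P ⟨$⟩ʳ i ≡ u × P ⟨$⟩ʳ j ≡ v) ⊎ (P ⟨$⟩ʳ i ≡ v × P ⟨$⟩ʳ j ≡ u))

Edge : HamiltonPath n → Rel (Fin n) 0ℓ
Edge P u v = ∃ λ t → EdgeAt P t u v

-- Equality of edge sets.  For n = 1 both edge sets are empty, so there is
-- exactly one Hamilton path up to _≈_.
infix 4 _≈_
_≈_ : Rel (HamiltonPath n) 0ℓ
P ≈ Q = Edge P ⇔ Edge Q

-- The edges of the subpath of P on the k + 1 vertices in positions
-- a , … , a + k; this is a subpath of P when a + k < n.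
SubpathEdge : HamiltonPath n → (a k : ℕ) → Rel (Fin n) 0ℓ
SubpathEdge P a k u v = ∃ λ t → a ≤ t × t < a + k × EdgeAt P t u v

HasSubpathDisjointFrom : ℕ → Rel (HamiltonPath n) 0ℓ
HasSubpathDisjointFrom {n} k P Q = ∃ λ a → a + k < n ×
  (∀ u v → SubpathEdge P a k u v → ¬ Edge Q u v)

Separated : ℕ → Rel (HamiltonPath n) 0ℓ
Separated k P Q = HasSubpathDisjointFrom k P Q ⊎ HasSubpathDisjointFrom k Q P

-- A family of m Hamilton paths is a set of them, hence the injectivity up to
-- _≈_ of the enumeration.
record Family (n k m : ℕ) : Set where
  field
    path      : Fin m → HamiltonPath n
    injective : Injective _≡_ _≈_ path
    separated : ∀ i j → i ≢ j → Separated k (path i) (path j)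

-- m is the maximum size of a family, that is, m = M(n,k).
IsMaximumSize : (n k m : ℕ) → Set
IsMaximumSize n k m = Family n k m × (∀ m′ → Family n k m′ → m′ ≤ m)

{-# OPTIONS --safe #-}
module Submission where

-- Put m = n / k and view positions and vertices as an m × k array, read row by row.
--
-- Lower bound: for a permutation π of the rows fixing row 0, let the path visit
-- (π i , j) at position (i , j) for even j and (i , j) for odd j.  If π and σ first
-- differ in row t, then the even columns of row t of the π-path are moved at least
-- one row down in the σ-path, while row t - 1 and the odd columns of row t stay
-- put.  Each of the k edges ending in row t joins a moved to an unmoved vertex, and
-- these are too far apart in the σ-path to be adjacent.
--
-- Upper bound: every subpath with k edges contains one of the m - 1 edges that join
-- two consecutive rows.  If two paths share these edges, they are not separated.
-- The edges are determined by the set of their first ends (tails), the set of their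
-- second ends (heads), which is a 3-colouring of the vertices, and an injection
-- from the m - 1 heads to the m tails, of which there are m!.

open import Defs
open import Data.Nat using (ℕ; NonZero; _≤_; _∸_; _*_; _^_; _/_; _%_; _!)
open import Data.Nat.Divisibility using (_∣_)
open import Data.Product using (_×_; ∃-syntax)
open import Relation.Binary.PropositionalEquality using (_≡_)

open import Data.Bool.Base using (Bool; true; false; not)
open import Data.Fin.Base
  using (Fin; zero; suc; toℕ; fromℕ; fromℕ<; pred; punchIn; punchOut;
         combine; quotient; remainder; remQuot; finToFun; funToFin)
open import Data.Fin.Patterns using (0F; 1F; 2F)
open import Data.Fin.Permutation as Perm
  using (Permutation′; permutation; _⟨$⟩ʳ_; _⟨$⟩ˡ_; inverseˡ; inverseʳ;
         insert; remove; lift₀; insert-remove)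
open import Data.Fin.Properties
  using (_≟_; toℕ<n; toℕ-fromℕ; toℕ-fromℕ<; toℕ-injective; toℕ-inject₁; suc-injective;
         punchIn-injective; punchOut-injective; toℕ-combine; combine-injective;
         combine-injectiveˡ; combine-surjective; combine-remQuot; remQuot-combine;
         finToFun-funToFin; any?; all?; pigeonhole; <⇒≢)
open import Data.Nat.Base
  using (zero; suc; _+_; _<_; z≤n; s≤s; z<s; s<s; s≤s⁻¹; >-nonZero; >-nonZero⁻¹; ≢-nonZero⁻¹)
open import Data.Nat.Divisibility using (divides; _∣?_; ∣⇒≤; ∣m+n∣m⇒∣n; m∣m*n; ∣1⇒≡1; 1∣_)
open import Data.Nat.DivMod using (m≡m%n+[m/n]*n; m%n<n; m/n*n≤m; m*n/n≡m)
import Data.Nat.Properties as ℕ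
open import Data.Product using (∃; ∃₂; _,_; proj₁; proj₂)
open import Data.Sum using (_⊎_; inj₁; inj₂; [_,_]; swap)
open import Function.Base using (_∘_)
open import Function.Bundles using (Injection)
open import Function.Properties.Inverse using (↔⇒↣)
open import Function.Definitions using (Injective)
open import Relation.Binary.Definitions using (tri<; tri≈; tri>)
open import Relation.Binary.PropositionalEquality
  using (_≢_; _≗_; refl; sym; trans; cong; cong₂; subst; module ≡-Reasoning)
open import Relation.Nullary using (¬_; Dec; yes; no; contradiction)
open import Relation.Nullary.Decidable using (map′; ¬?; _×-dec_; _⊎-dec_; _→-dec_)
open import Relation.Unary using (Pred; Decidable)

private
  variable
    a b m n k : ℕ

-- Enumerating permutations and injections

-- Lehmer code: the leading digit is the image of `zero`, and the remaining digits encode the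
-- permutation left after deleting `zero` and its image.
perm : Fin (m !) → Permutation′ m
perm {zero}  _ = Perm.id
perm {suc m} x = let i , y = remQuot {suc m} (m !) x in insert zero i (perm y)

perm-combine : ∀ (i : Fin (suc m)) (y : Fin (m !)) →
  perm (combine i y) ≡ insert zero i (perm y)
perm-combine i y = cong (λ (j , z) → insert zero j (perm z)) (remQuot-combine i y)

perm-surjective : (π : Permutation′ m) → ∃ λ x → perm x Perm.≈ π
perm-surjective {zero}  π = zero , λ ()
perm-surjective {suc m} π with perm-surjective (remove zero π)
... | y , y≈ = combine (π ⟨$⟩ʳ zero) y , λ s →
  trans (cong (_⟨$⟩ʳ s) (perm-combine (π ⟨$⟩ʳ zero) y)) (trans (insert-y s) (insert-remove zero π s))
  where
  insert-y : insert zero (π ⟨$⟩ʳ zero) (perm y) Perm.≈ insert zero (π ⟨$⟩ʳ zero) (remove zero π)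
  insert-y zero    = refl
  insert-y (suc s) = cong (punchIn (π ⟨$⟩ʳ zero)) (y≈ s)

FirstDifference : (π σ : Permutation′ m) → Fin m → Set
FirstDifference π σ t =
  (∀ s → toℕ s < toℕ t → π ⟨$⟩ʳ s ≡ σ ⟨$⟩ʳ s) × π ⟨$⟩ʳ t ≢ σ ⟨$⟩ʳ t

insert-firstDifference : ∀ {i j} {π σ : Permutation′ m} → (i ≡ j → ∃ (FirstDifference π σ)) →
  ∃ (FirstDifference (insert zero i π) (insert zero j σ))
insert-firstDifference {i = i} {j} {π} {σ} diff with i ≟ j
... | no  i≢j  = zero , (λ _ ()) , i≢j
... | yes refl with diff refl
...   | t , agree , differ = suc t , agree′ , differ ∘ punchIn-injective i _ _
  where
  agree′ : ∀ s → toℕ s < suc (toℕ t) → insert zero i π ⟨$⟩ʳ s ≡ insert zero i σ ⟨$⟩ʳ s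
  agree′ zero    _   = refl
  agree′ (suc s) s<t = cong (punchIn i) (agree s (s≤s⁻¹ s<t))

-- The first digit in which two codes differ marks the first place where the permutations differ:
-- equal leading digits apply the same `punchIn` to both remainders.
perm-firstDifference : ∀ {x y : Fin (m !)} → x ≢ y → ∃ (FirstDifference (perm {m} x) (perm y))
perm-firstDifference {zero}  {zero} {zero} x≢y = contradiction refl x≢y
perm-firstDifference {suc m} {x}    {y}    x≢y = insert-firstDifference λ i≡j →
  perm-firstDifference {m} λ r≡r′ → x≢y (begin
    x
      ≡⟨ combine-remQuot {suc m} (m !) x ⟨
    combine (quotient {suc m} (m !) x) (remainder {suc m} (m !) x)
      ≡⟨ cong₂ combine i≡j r≡r′ ⟩
    combine (quotient {suc m} (m !) y) (remainder {suc m} (m !) y)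
      ≡⟨ combine-remQuot {suc m} (m !) y ⟩
    y ∎)
  where open ≡-Reasoning

module _ {f : Fin (suc a) → Fin (suc b)} (inj : Injective _≡_ _≡_ f) where

  head≢ : ∀ i → f zero ≢ f (suc i)
  head≢ i eq with () ← inj eq

  punchTail : Fin a → Fin b
  punchTail i = punchOut (head≢ i)

  punchTail-injective : Injective _≡_ _≡_ punchTail
  punchTail-injective eq = suc-injective (inj (punchOut-injective (head≢ _) (head≢ _) eq))

-- The digits of `perm` again, broken off after `a` of them. The last argument of `combine` is then
-- constant, so each injection uses up one code out of b !.
rank : {f : Fin a → Fin b} → Injective _≡_ _≡_ f → Fin (b !)
rank {zero}  {b}         _   = fromℕ< (ℕ.1≤n! b)
rank {suc a} {zero}  {f} _   with () ← f zero
rank {suc a} {suc b} {f} inj = combine (f zero) (rank (punchTail-injective inj))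

rank-injective : {f g : Fin a → Fin b} (f-inj : Injective _≡_ _≡_ f) (g-inj : Injective _≡_ _≡_ g) →
  rank f-inj ≡ rank g-inj → f ≗ g
rank-injective {suc a} {zero}  {f} _ _ _ with () ← f zero
rank-injective {suc a} {suc b} {f} {g} f-inj g-inj eq = ranked
  where
  eqs = combine-injective (f zero) _ (g zero) _ eq

  punchOut-cancel : ∀ {n} {i i′ j j′ : Fin (suc n)} {i≢j : i ≢ j} {i′≢j′ : i′ ≢ j′} →
    i ≡ i′ → punchOut i≢j ≡ punchOut i′≢j′ → j ≡ j′
  punchOut-cancel {i≢j = i≢j} {i′≢j′} refl = punchOut-injective i≢j i′≢j′

  ranked : f ≗ g
  ranked zero    = proj₁ eqs
  ranked (suc i) = punchOut-cancel (proj₁ eqs) (rank-injective _ _ (proj₂ eqs) i)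

-- Hamilton paths

Adjacent : ℕ → ℕ → Set
Adjacent x y = suc x ≡ y ⊎ suc y ≡ x

far⇒¬adjacent : ∀ {x y} → suc x < y → ¬ Adjacent x y
far⇒¬adjacent 1+x<y (inj₁ refl) = ℕ.<-irrefl refl 1+x<y
far⇒¬adjacent 1+x<y (inj₂ refl) = ℕ.<-asym 1+x<y (ℕ.m<n⇒m<1+n (ℕ.n<1+n _))

-- Reduces edge-disjointness to arithmetic: `Q ⟨$⟩ˡ (P ⟨$⟩ʳ i)` is the position in `Q` of the vertex
-- at position `i` of `P`.
shared-edge : ∀ (P Q : HamiltonPath n) {t u v} → EdgeAt P t u v → Edge Q u v →
  ∃₂ λ i j → toℕ i ≡ t × toℕ j ≡ suc t ×
    Adjacent (toℕ (Q ⟨$⟩ˡ (P ⟨$⟩ʳ i))) (toℕ (Q ⟨$⟩ˡ (P ⟨$⟩ʳ j)))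
shared-edge P Q {t} (i , j , i≡t , j≡1+t , P-ends) (t′ , i′ , j′ , i′≡t′ , j′≡1+t′ , Q-ends) =
  i , j , i≡t , j≡1+t , ends P-ends Q-ends
  where
  position : ∀ {l l′ w} → P ⟨$⟩ʳ l ≡ w → Q ⟨$⟩ʳ l′ ≡ w → Q ⟨$⟩ˡ (P ⟨$⟩ʳ l) ≡ l′
  position Pl≡w Ql′≡w = trans (cong (Q ⟨$⟩ˡ_) (trans Pl≡w (sym Ql′≡w))) (inverseˡ Q)

  successive : suc (toℕ i′) ≡ toℕ j′
  successive = trans (cong suc i′≡t′) (sym j′≡1+t′)

  adjacent : ∀ {x y} → (x ≡ i′ × y ≡ j′) ⊎ (x ≡ j′ × y ≡ i′) → Adjacent (toℕ x) (toℕ y)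
  adjacent (inj₁ (refl , refl)) = inj₁ successive
  adjacent (inj₂ (refl , refl)) = inj₂ successive

  ends : ∀ {u v} → (P ⟨$⟩ʳ i ≡ u × P ⟨$⟩ʳ j ≡ v) ⊎ (P ⟨$⟩ʳ i ≡ v × P ⟨$⟩ʳ j ≡ u) →
    (Q ⟨$⟩ʳ i′ ≡ u × Q ⟨$⟩ʳ j′ ≡ v) ⊎ (Q ⟨$⟩ʳ i′ ≡ v × Q ⟨$⟩ʳ j′ ≡ u) →
    Adjacent (toℕ (Q ⟨$⟩ˡ (P ⟨$⟩ʳ i))) (toℕ (Q ⟨$⟩ˡ (P ⟨$⟩ʳ j)))
  ends (inj₁ (p , p′)) (inj₁ (q , q′)) = adjacent (inj₁ (position p q , position p′ q′))
  ends (inj₁ (p , p′)) (inj₂ (q , q′)) = adjacent (inj₂ (position p q′ , position p′ q))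
  ends (inj₂ (p , p′)) (inj₁ (q , q′)) = adjacent (inj₂ (position p q′ , position p′ q))
  ends (inj₂ (p , p′)) (inj₂ (q , q′)) = adjacent (inj₁ (position p q , position p′ q′))

edgeAt-resp : ∀ (P P′ : HamiltonPath n) → P Perm.≈ P′ → ∀ {t u v} → EdgeAt P t u v → EdgeAt P′ t u v
edgeAt-resp P P′ P≈P′ (i , j , i≡t , j≡1+t , ends) = i , j , i≡t , j≡1+t , resp ends
  where
  resp : ∀ {u v} → (P ⟨$⟩ʳ i ≡ u × P ⟨$⟩ʳ j ≡ v) ⊎ (P ⟨$⟩ʳ i ≡ v × P ⟨$⟩ʳ j ≡ u) →
    (P′ ⟨$⟩ʳ i ≡ u × P′ ⟨$⟩ʳ j ≡ v) ⊎ (P′ ⟨$⟩ʳ i ≡ v × P′ ⟨$⟩ʳ j ≡ u)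
  resp (inj₁ (p , p′)) = inj₁ (trans (sym (P≈P′ i)) p , trans (sym (P≈P′ j)) p′)
  resp (inj₂ (p , p′)) = inj₂ (trans (sym (P≈P′ i)) p , trans (sym (P≈P′ j)) p′)

disjoint-resp : ∀ (P P′ Q Q′ : HamiltonPath n) → P Perm.≈ P′ → Q Perm.≈ Q′ →
  HasSubpathDisjointFrom k P Q → HasSubpathDisjointFrom k P′ Q′
disjoint-resp P P′ Q Q′ P≈P′ Q≈Q′ (a , a+k<n , disjoint) = a , a+k<n ,
  λ u v (t , a≤t , t<a+k , e) (t′ , e′) → disjoint u v
    (t , a≤t , t<a+k , edgeAt-resp P′ P (sym ∘ P≈P′) e) (t′ , edgeAt-resp Q′ Q (sym ∘ Q≈Q′) e′)

separated-resp : ∀ (P P′ Q Q′ : HamiltonPath n) → P Perm.≈ P′ → Q Perm.≈ Q′ →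
  Separated k P Q → Separated k P′ Q′
separated-resp P P′ Q Q′ P≈P′ Q≈Q′ (inj₁ d) = inj₁ (disjoint-resp P P′ Q Q′ P≈P′ Q≈Q′ d)
separated-resp P P′ Q Q′ P≈P′ Q≈Q′ (inj₂ d) = inj₂ (disjoint-resp Q Q′ P P′ Q≈Q′ P≈P′ d)

disjoint⇒edge⊈ : .{{_ : NonZero k}} (P Q : HamiltonPath n) → HasSubpathDisjointFrom k P Q →
  ¬ (∀ {u v} → Edge P u v → Edge Q u v)
disjoint⇒edge⊈ {k} {n} P Q (a , a+k<n , disjoint) P⊆Q =
  disjoint _ _ (a , ℕ.≤-refl , a<a+k , e) (P⊆Q (a , e))
  where
  a<a+k : a < a + k
  a<a+k = ℕ.m<m+n a (>-nonZero⁻¹ k)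

  1+a<n : suc a < n
  1+a<n = ℕ.≤-<-trans a<a+k a+k<n

  e : EdgeAt P a _ _
  e = fromℕ< (ℕ.<-trans a<a+k a+k<n) , fromℕ< 1+a<n , toℕ-fromℕ< _ , toℕ-fromℕ< _ , inj₁ (refl , refl)

-- As k ≥ 1, a disjoint subpath of one path contains an edge missing from the other, so separated
-- paths have different edge sets.
separated⇒family : .{{_ : NonZero k}} (path : Fin m → HamiltonPath n) →
  (∀ i j → i ≢ j → Separated k (path i) (path j)) → Family n k m
separated⇒family path separated = record
  { path = path ; injective = injective ; separated = separated }
  where
  injective : Injective _≡_ _≈_ path
  injective {i} {j} (i⊆j , j⊆i) with i ≟ j
  ... | yes i≡j = i≡j
  ... | no  i≢j = contradiction (separated i j i≢j)
    [ (λ d → disjoint⇒edge⊈ (path i) (path j) d i⊆j)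
    , (λ d → disjoint⇒edge⊈ (path j) (path i) d j⊆i) ]

-- Existence of the maximum

edgeAt? : ∀ (P : HamiltonPath n) t u v → Dec (EdgeAt P t u v)
edgeAt? P t u v = any? λ i → any? λ j → (toℕ i ℕ.≟ t) ×-dec (toℕ j ℕ.≟ suc t) ×-dec
  (((P ⟨$⟩ʳ i ≟ u) ×-dec (P ⟨$⟩ʳ j ≟ v)) ⊎-dec ((P ⟨$⟩ʳ i ≟ v) ×-dec (P ⟨$⟩ʳ j ≟ u)))

edge? : ∀ (P : HamiltonPath n) u v → Dec (Edge P u v)
edge? {n} P u v = map′
  (λ (t , _ , e) → t , e)
  (λ (t , e) → t , subst (_< n) (proj₁ (proj₂ (proj₂ e))) (toℕ<n (proj₁ e)) , e)
  (ℕ.anyUpTo? (λ t → edgeAt? P t u v) n)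

subpathEdge? : ∀ (P : HamiltonPath n) a k u v → Dec (SubpathEdge P a k u v)
subpathEdge? P a k u v = map′
  (λ (t , t<a+k , a≤t , e) → t , a≤t , t<a+k , e)
  (λ (t , a≤t , t<a+k , e) → t , t<a+k , a≤t , e)
  (ℕ.anyUpTo? (λ t → (a ℕ.≤? t) ×-dec edgeAt? P t u v) (a + k))

hasSubpathDisjointFrom? : ∀ k (P Q : HamiltonPath n) → Dec (HasSubpathDisjointFrom k P Q)
hasSubpathDisjointFrom? {n} k P Q = map′
  (λ (a , _ , d) → a , d)
  (λ (a , d) → a , ℕ.≤-<-trans (ℕ.m≤m+n a k) (proj₁ d) , d)
  (ℕ.anyUpTo? (λ a → (a + k ℕ.<? n) ×-dec
    all? λ u → all? λ v → subpathEdge? P a k u v →-dec ¬? (edge? Q u v)) n)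

separated? : ∀ k (P Q : HamiltonPath n) → Dec (Separated k P Q)
separated? k P Q = hasSubpathDisjointFrom? k P Q ⊎-dec hasSubpathDisjointFrom? k Q P

-- Finite search over the (n !)^m tuples of Lehmer codes. Every path agrees pointwise with some
-- `perm x`, and separation respects pointwise equality.
family? : ∀ n k .{{_ : NonZero k}} m → Dec (Family n k m)
family? n k m = map′ (λ (c , s) → separated⇒family (paths c) s) code
  (any? λ c → all? λ i → all? λ j → ¬? (i ≟ j) →-dec separated? k (paths c i) (paths c j))
  where
  paths : Fin ((n !) ^ m) → Fin m → HamiltonPath n
  paths c = perm ∘ finToFun c

  code : Family n k m → ∃ λ c → ∀ i j → i ≢ j → Separated k (paths c i) (paths c j)
  code F = c , λ i j i≢j → separated-resp (path i) (paths c i) (path j) (paths c j)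
    (sym ∘ paths-c i) (sym ∘ paths-c j) (separated i j i≢j)
    where
    open Family F
    index = proj₁ ∘ perm-surjective ∘ path
    c = funToFin index

    paths-c : ∀ i → paths c i Perm.≈ path i
    paths-c i s = trans (cong (λ x → perm x ⟨$⟩ʳ s) (finToFun-funToFin index i))
                        (proj₂ (perm-surjective (path i)) s)

-- Tests the candidates downwards from the bound; `P0` ends the search at the latest.
maximum : ∀ {p} {P : Pred ℕ p} → Decidable P → P 0 → ∀ b → (∀ m → P m → m ≤ b) →
  ∃ λ M → P M × (∀ m → P m → m ≤ M)
maximum P? P0 zero    bound = 0 , P0 , bound
maximum P? P0 (suc b) bound with P? (suc b)
... | yes Pb = suc b , Pb , bound
... | no ¬Pb = maximum P? P0 b λ m Pm → s≤s⁻¹ (ℕ.≤∧≢⇒< (bound m Pm) λ { refl → ¬Pb Pm })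

-- Lower bound

onColumns : (Fin k → Fin m → Fin m) → Fin (m * k) → Fin (m * k)
onColumns {k} f p = let i , j = remQuot k p in combine (f j i) j

onColumns-combine : ∀ (f : Fin k → Fin m → Fin m) i j → onColumns f (combine i j) ≡ combine (f j i) j
onColumns-combine f i j = cong (λ (i , j) → combine (f j i) j) (remQuot-combine i j)

onColumns-inverse : (f g : Fin k → Fin m → Fin m) → (∀ j i → f j (g j i) ≡ i) →
  ∀ p → onColumns f (onColumns g p) ≡ p
onColumns-inverse {k} {m} f g inv p with combine-surjective {m} {k} p
... | i , j , refl = begin
  onColumns f (onColumns g (combine i j)) ≡⟨ cong (onColumns f) (onColumns-combine g i j) ⟩
  onColumns f (combine (g j i) j)         ≡⟨ onColumns-combine f (g j i) j ⟩
  combine (f j (g j i)) j                 ≡⟨ cong (λ i → combine i j) (inv j i) ⟩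
  combine i j                             ∎
  where open ≡-Reasoning

columnwise : (Fin k → Permutation′ m) → Permutation′ (m * k)
columnwise {k} {m} ρ = permutation (onColumns to) (onColumns from)
  (onColumns-inverse to from λ j _ → inverseʳ (ρ j)) (onColumns-inverse from to λ j _ → inverseˡ (ρ j))
  where
  to from : Fin k → Fin m → Fin m
  to   j = ρ j ⟨$⟩ʳ_
  from j = ρ j ⟨$⟩ˡ_

columnwise-quotient : ∀ (ρ τ : Fin k → Permutation′ m) i j →
  columnwise τ ⟨$⟩ˡ (columnwise ρ ⟨$⟩ʳ combine i j) ≡ combine (τ j ⟨$⟩ˡ (ρ j ⟨$⟩ʳ i)) j
columnwise-quotient ρ τ i j = trans
  (cong (columnwise τ ⟨$⟩ˡ_) (onColumns-combine (λ j → ρ j ⟨$⟩ʳ_) i j))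
  (onColumns-combine (λ j → τ j ⟨$⟩ˡ_) (ρ j ⟨$⟩ʳ i) j)

even : ℕ → Bool
even zero    = true
even (suc x) = not (even x)

onlyIf : Bool → Permutation′ m → Permutation′ m
onlyIf true  π = π
onlyIf false π = Perm.id

-- Position k i + j visits vertex k (π i) + j if j is even and k i + j if j is odd.
weave : ∀ k → Permutation′ m → HamiltonPath (m * k)
weave k π = columnwise λ j → onlyIf (even (toℕ j)) π

-- The first difference lies in a row `suc t`, so there is a row before it, in which the disjoint
-- subpath can start.
module _ {q k : ℕ} {π σ : Permutation′ (suc q)} {t : Fin q}
         (diff : FirstDifference π σ (suc t)) where
  private
    P = weave k π
    Q = weave k σ

    -- Where in `Q` the vertex at position `p` of `P` is found.
    D : Fin (suc q * k) → Fin (suc q * k)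
    D p = Q ⟨$⟩ˡ (P ⟨$⟩ʳ p)

    base = k * suc (toℕ t)

  shift : Bool → Fin (suc q) → Fin (suc q)
  shift b i = onlyIf b σ ⟨$⟩ˡ (onlyIf b π ⟨$⟩ʳ i)

  D-combine : ∀ i j → D (combine i j) ≡ combine (shift (even (toℕ j)) i) j
  D-combine = columnwise-quotient (λ j → onlyIf (even (toℕ j)) π) (λ j → onlyIf (even (toℕ j)) σ)

  D-agree : ∀ i j → toℕ i < suc (toℕ t) → D (combine i j) ≡ combine i j
  D-agree i j i<t = trans (D-combine i j) (cong (λ l → combine l j) (lemma (even (toℕ j))))
    where
    lemma : ∀ b → shift b i ≡ i
    lemma true  = trans (cong (σ ⟨$⟩ˡ_) (proj₁ diff i i<t)) (inverseˡ σ)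
    lemma false = refl

  D-odd : ∀ i j → even (toℕ j) ≡ false → D (combine i j) ≡ combine i j
  D-odd i j e = trans (D-combine i j) (cong (λ b → combine (shift b i) j) e)

  -- The image is not `suc t`, where π and σ differ, and it is no earlier row s, since σ s = π s
  -- there and π is injective.
  later : suc (toℕ t) < toℕ (σ ⟨$⟩ˡ (π ⟨$⟩ʳ suc t))
  later with ℕ.<-cmp (suc (toℕ t)) (toℕ (σ ⟨$⟩ˡ (π ⟨$⟩ʳ suc t)))
  ... | tri< lt _ _ = lt
  ... | tri≈ _ eq _ = contradiction
    (trans (sym (inverseʳ σ)) (cong (σ ⟨$⟩ʳ_) (sym (toℕ-injective eq)))) (proj₂ diff)
  ... | tri> _ _ gt = contradiction (cong toℕ (Injection.injective (↔⇒↣ π)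
    (trans (proj₁ diff _ gt) (inverseʳ σ)))) (ℕ.<⇒≢ gt)

  D-even : ∀ j → even (toℕ j) ≡ true → toℕ (combine (suc t) j) + k ≤ toℕ (D (combine (suc t) j))
  D-even j e = begin
    toℕ (combine (suc t) j) + k             ≡⟨ cong (_+ k) (toℕ-combine (suc t) j) ⟩
    (base + toℕ j) + k                      ≡⟨ ℕ.+-comm _ k ⟩
    k + (base + toℕ j)                      ≡⟨ ℕ.+-assoc k base (toℕ j) ⟨
    (k + base) + toℕ j                      ≡⟨ cong (_+ toℕ j) (ℕ.*-suc k (suc (toℕ t))) ⟨
    k * suc (suc (toℕ t)) + toℕ j           ≤⟨ ℕ.+-monoˡ-≤ (toℕ j) (ℕ.*-monoʳ-≤ k later) ⟩
    k * toℕ t′ + toℕ j                      ≡⟨ toℕ-combine t′ j ⟨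
    toℕ (combine t′ j)                      ≡⟨ cong (λ b → toℕ (combine (shift b (suc t)) j)) e ⟨
    toℕ (combine (shift (even (toℕ j)) (suc t)) j)
                                            ≡⟨ cong toℕ (D-combine (suc t) j) ⟨
    toℕ (D (combine (suc t) j))             ∎
    where
    open ℕ.≤-Reasoning
    t′ = σ ⟨$⟩ˡ (π ⟨$⟩ʳ suc t)

  D-before : ∀ p → toℕ p < base → D p ≡ p
  D-before p p<base with combine-surjective {suc q} {k} p
  ... | i , j , refl = D-agree i j (ℕ.*-cancelˡ-< k _ _ (ℕ.≤-<-trans
    (subst (k * toℕ i ≤_) (sym (toℕ-combine i j)) (ℕ.m≤m+n _ _)) p<base))

  D-row : ∀ p {c} → c < k → toℕ p ≡ base + c →
    (even c ≡ false × D p ≡ p) ⊎ (even c ≡ true × toℕ p + k ≤ toℕ (D p))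
  D-row p {c} c<k eq with p≡ ← toℕ-injective {i = p} {combine (suc t) (fromℕ< c<k)}
    (trans eq (sym (trans (toℕ-combine (suc t) (fromℕ< c<k)) (cong (base +_) (toℕ-fromℕ< c<k)))))
    with even c in e
  ... | false rewrite p≡ = inj₁ (refl , D-odd (suc t) _ (trans (cong even (toℕ-fromℕ< c<k)) e))
  ... | true  rewrite p≡ = inj₂ (refl , D-even _ (trans (cong even (toℕ-fromℕ< c<k)) e))

  D-apart : ∀ {p q} → D p ≡ p → suc (toℕ p) ≡ toℕ q → 0 < k → toℕ q + k ≤ toℕ (D q) →
    ¬ Adjacent (toℕ (D p)) (toℕ (D q))
  D-apart {p} {q} Dp≡p 1+p≡q 0<k q+k≤Dq = far⇒¬adjacent (begin-strict
    suc (toℕ (D p)) ≡⟨ cong (suc ∘ toℕ) Dp≡p ⟩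
    suc (toℕ p)     ≡⟨ 1+p≡q ⟩
    toℕ q           <⟨ ℕ.m<m+n (toℕ q) 0<k ⟩
    toℕ q + k       ≤⟨ q+k≤Dq ⟩
    toℕ (D q)       ∎)
    where open ℕ.≤-Reasoning

  -- If `j` is moved, it lands at j + k or later, past the successor of the unmoved `i`. If `i` is
  -- moved, it jumps over the unmoved `j` and lands at i + k or later, which is beyond j + 1 once k
  -- > 2. For c = 0 the end `i` lies before the row and is unmoved.
  D-far : k % 2 ≡ 1 → ∀ i j c → c < k → toℕ j ≡ base + c → suc (toℕ i) ≡ toℕ j →
    ¬ Adjacent (toℕ (D i)) (toℕ (D j))
  D-far odd i j zero 0<k j≡ 1+i≡j with D-row j 0<k j≡
  ... | inj₁ (() , _)
  ... | inj₂ (_ , j+k≤Dj) = D-apart (D-before i (ℕ.≤-reflexive (trans 1+i≡j (trans j≡ (ℕ.+-identityʳ _)))))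
    1+i≡j 0<k j+k≤Dj
  D-far odd i j (suc c) 1+c<k j≡ 1+i≡j
    with D-row i (ℕ.<-trans (ℕ.n<1+n c) 1+c<k) (ℕ.suc-injective (trans 1+i≡j (trans j≡ (ℕ.+-suc base c))))
       | D-row j 1+c<k j≡
  ... | inj₁ (_ , Di≡i) | inj₂ (_ , j+k≤Dj) = D-apart Di≡i 1+i≡j (ℕ.<-trans z<s 1+c<k) j+k≤Dj
  ... | inj₁ (e , _)    | inj₁ (e′ , _)     with () ← trans (cong not (sym e)) e′
  ... | inj₂ (e , _)    | inj₂ (e′ , _)     with () ← trans (cong not (sym e)) e′
  ... | inj₂ (_ , i+k≤Di) | inj₁ (_ , Dj≡j) = far⇒¬adjacent (begin-strict
    suc (toℕ (D j))     ≡⟨ cong (suc ∘ toℕ) Dj≡j ⟩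
    suc (toℕ j)         ≡⟨ cong suc 1+i≡j ⟨
    2 + toℕ i           ≡⟨ ℕ.+-comm 2 (toℕ i) ⟩
    toℕ i + 2           <⟨ ℕ.+-monoʳ-< (toℕ i) 2<k ⟩
    toℕ i + k           ≤⟨ i+k≤Di ⟩
    toℕ (D i)           ∎) ∘ swap
    where
    open ℕ.≤-Reasoning

    -- For k = 2 a vertex moved down by one row could land right after its
    -- former successor, and the edge would survive.
    2<k : 2 < k
    2<k = ℕ.≤∧≢⇒< (ℕ.≤-trans (s≤s (s≤s z≤n)) 1+c<k) λ { refl → contradiction odd λ () }

  weave-disjoint : k % 2 ≡ 1 → HasSubpathDisjointFrom k P Q
  -- The subpath starts at the last position of row `t`, one before `base`, and runs to the end of
  -- row `suc t`.
  weave-disjoint odd = k * toℕ t + (k ∸ 1) , window<n , λ u v (τ , a≤τ , τ<a+k , e) e′ →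
    let i , j , i≡τ , j≡1+τ , adjacent = shared-edge P Q e e′ in
    -- The edge at position τ has its later end in column suc τ ∸ base.
    D-far odd i j (suc τ ∸ base) (c<k τ<a+k) (trans j≡1+τ (sym (c-eq a≤τ)))
      (trans (cong suc i≡τ) (sym j≡1+τ)) adjacent
    where
    0<k : 0 < k
    0<k = ℕ.n≢0⇒n>0 λ { refl → contradiction odd λ () }

    1+a≡base : suc (k * toℕ t + (k ∸ 1)) ≡ base
    1+a≡base = begin
      suc (k * toℕ t + (k ∸ 1)) ≡⟨ ℕ.+-suc (k * toℕ t) (k ∸ 1) ⟨
      k * toℕ t + suc (k ∸ 1)   ≡⟨ cong (k * toℕ t +_) (ℕ.m+[n∸m]≡n 0<k) ⟩
      k * toℕ t + k             ≡⟨ ℕ.+-comm _ k ⟩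
      k + k * toℕ t             ≡⟨ ℕ.*-suc k (toℕ t) ⟨
      base                      ∎
      where open ≡-Reasoning

    window<n : k * toℕ t + (k ∸ 1) + k < suc q * k
    window<n = begin
      suc (k * toℕ t + (k ∸ 1)) + k ≡⟨ cong (_+ k) 1+a≡base ⟩
      base + k                      ≡⟨ ℕ.+-comm base k ⟩
      k + base                      ≤⟨ ℕ.+-monoʳ-≤ k (ℕ.*-monoʳ-≤ k (toℕ<n t)) ⟩
      k + k * q                     ≡⟨ cong (k +_) (ℕ.*-comm k q) ⟩
      suc q * k                     ∎
      where open ℕ.≤-Reasoning

    module _ {τ : ℕ} where
      c-eq : k * toℕ t + (k ∸ 1) ≤ τ → base + (suc τ ∸ base) ≡ suc τ
      c-eq a≤τ = ℕ.m+[n∸m]≡n (subst (_≤ suc τ) 1+a≡base (s≤s a≤τ))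

      c<k : τ < k * toℕ t + (k ∸ 1) + k → suc τ ∸ base < k
      c<k τ<a+k = ℕ.m<n+o⇒m∸n<o (suc τ) base {{>-nonZero 0<k}}
        (subst (λ x → suc τ < x + k) 1+a≡base (s<s τ<a+k))

-- `lift₀` fixes row 0, which forces every first difference into a successor row and leaves q ! of
-- the permutations of the suc q rows.
lower-bound : k % 2 ≡ 1 → ∀ q → Family (suc q * k) k (q !)
lower-bound {k} odd q = separated⇒family {{>-nonZero 0<k}} path λ x y x≢y →
  inj₁ (weave-disjoint (proj₂ (difference x≢y)) odd)
  where
  0<k : 0 < k
  0<k = ℕ.n≢0⇒n>0 λ { refl → contradiction odd λ () }

  π : Fin (q !) → Permutation′ (suc q)
  π x = lift₀ (perm {q} x)

  path : Fin (q !) → HamiltonPath (suc q * k)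
  path x = weave k (π x)

  difference : ∀ {x y} → x ≢ y → ∃ λ t → FirstDifference (π x) (π y) (suc t)
  difference x≢y = let t , agree , differ = perm-firstDifference {q} x≢y in
    t , (λ { zero _ → refl ; (suc s) s<t → cong suc (agree s (s≤s⁻¹ s<t)) }) , differ ∘ suc-injective

-- Upper bound

module _ (k : ℕ) where

  -- Tails are the last positions of rows, heads the first positions of rows other than row 0. The
  -- final tail of the array precedes no head, so suc q rows have suc q tails and q heads.
  Tail Head : ℕ → Set
  Tail x = k ∣ suc x
  Head x = x ≢ 0 × k ∣ x

  head? : ∀ x → Dec (Head x)
  head? x = ¬? (x ℕ.≟ 0) ×-dec (k ∣? x)

  -- A position that is both a head and a tail gets colour 0F; this loses
  -- nothing, as it occurs only for k = 1, when every position is a tail.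
  colourOf : ∀ {x} → Dec (Head x) → Dec (Tail x) → Fin 3
  colourOf (yes _) _       = 0F
  colourOf (no _)  (yes _) = 1F
  colourOf (no _)  (no _)  = 2F

  colour : ℕ → Fin 3
  colour x = colourOf (head? x) (k ∣? suc x)

  colour-head : ∀ {x y} → colour x ≡ colour y → Head x → Head y
  colour-head {x} {y} eq h with head? x | k ∣? suc x | head? y | k ∣? suc y
  ... | _     | _ | yes h′ | _     = h′
  ... | no ¬h | _ | no _   | _     = contradiction h ¬h
  ... | yes _ | _ | no _   | yes _ with () ← eq
  ... | yes _ | _ | no _   | no _  with () ← eq

  colour-tail : ∀ {x y} → colour x ≡ colour y → Tail x → Tail y
  colour-tail {x} {y} eq t with head? x | k ∣? suc x | head? y | k ∣? suc y
  ... | _     | _     | _     | yes t′ = t′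
  ... | _     | no ¬t | _     | no _   = contradiction t ¬t
  ... | no _  | yes _ | yes _ | no _   with () ← eq
  ... | no _  | yes _ | no _  | no _   with () ← eq
  ... | yes _ | yes _ | no _  | no _   with () ← eq
  -- Here k divides both x and suc x, so k = 1 and `y` is a tail after all.
  ... | yes (_ , k∣x) | yes _ | yes _ | no ¬t =
    contradiction (subst (_∣ suc y) (sym (∣1⇒≡1 (∣m+n∣m⇒∣n (subst (k ∣_) (ℕ.+-comm 1 x) t) k∣x))) (1∣ suc y)) ¬t

suc-pred : ∀ (p : Fin n) → toℕ p ≢ 0 → suc (toℕ (pred p)) ≡ toℕ p
suc-pred zero    p≢0 = contradiction refl p≢0
suc-pred (suc p) _   = cong suc (toℕ-inject₁ p)

pred-tail : ∀ (p : Fin n) → Head k (toℕ p) → Tail k (toℕ (pred p))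
pred-tail {k = k} p (p≢0 , k∣p) = subst (k ∣_) (sym (suc-pred p p≢0)) k∣p

-- `Q` traverses every row-joining edge of `P` in the same direction and again between rows. The
-- `Head` clause also keeps `pred` in `Q` away from its default value at position 0.
Linked : ℕ → (P Q : HamiltonPath n) → Set
Linked k P Q = ∀ p → Head k (toℕ p) →
  Q ⟨$⟩ʳ pred (Q ⟨$⟩ˡ (P ⟨$⟩ʳ p)) ≡ P ⟨$⟩ʳ pred p × Head k (toℕ (Q ⟨$⟩ˡ (P ⟨$⟩ʳ p)))

linked⇒¬disjoint : .{{_ : NonZero k}} (P Q : HamiltonPath n) → Linked k P Q →
  ¬ HasSubpathDisjointFrom k P Q
linked⇒¬disjoint {k} {n} P Q linked (a , a+k<n , disjoint) =
  disjoint _ _ (toℕ (pred p) , a≤t , t<a+k , (pred p , p , refl , sym 1+t≡p , inj₁ (refl , refl)))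
    (toℕ (pred p′) , (pred p′ , p′ , refl , sym (suc-pred p′ (proj₁ head′)) , inj₁ (link , inverseʳ Q)))
  where
  -- The least multiple of k above `a`. It is at most a + k, so the edge ending at position x lies
  -- in the subpath and joins two rows.
  x = k * suc (a / k)

  a<x : a < x
  a<x = begin-strict
    a                       ≡⟨ m≡m%n+[m/n]*n a k ⟩
    a % k + a / k * k       <⟨ ℕ.+-monoˡ-< (a / k * k) (m%n<n a k) ⟩
    suc (a / k) * k         ≡⟨ ℕ.*-comm (suc (a / k)) k ⟩
    x                       ∎
    where open ℕ.≤-Reasoning

  x≤a+k : x ≤ a + k
  x≤a+k = begin
    k * suc (a / k)         ≡⟨ ℕ.*-comm k (suc (a / k)) ⟩
    k + a / k * k           ≤⟨ ℕ.+-monoʳ-≤ k (m/n*n≤m a k) ⟩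
    k + a                   ≡⟨ ℕ.+-comm k a ⟩
    a + k                   ∎
    where open ℕ.≤-Reasoning

  p : Fin n
  p = fromℕ< (ℕ.≤-<-trans x≤a+k a+k<n)

  p≡x : toℕ p ≡ x
  p≡x = toℕ-fromℕ< _

  p≢0 : toℕ p ≢ 0
  p≢0 = ℕ.n>0⇒n≢0 (subst (0 <_) (sym p≡x) (ℕ.≤-<-trans z≤n a<x))

  1+t≡p : suc (toℕ (pred p)) ≡ toℕ p
  1+t≡p = suc-pred p p≢0

  p′ = Q ⟨$⟩ˡ (P ⟨$⟩ʳ p)

  linked-p = linked p (p≢0 , subst (k ∣_) (sym p≡x) (m∣m*n (suc (a / k))))
  link  = proj₁ linked-p
  head′ = proj₂ linked-p

  a≤t : a ≤ toℕ (pred p)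
  a≤t = s≤s⁻¹ (subst (a <_) (sym (trans 1+t≡p p≡x)) a<x)

  t<a+k : toℕ (pred p) < a + k
  t<a+k = subst (_≤ a + k) (sym (trans 1+t≡p p≡x)) x≤a+k

module _ {q k : ℕ} where
  private
    K = suc k
    N = suc q * K

  tail-column : ∀ (i : Fin (suc q)) (j : Fin K) → Tail K (toℕ (combine i j)) → j ≡ fromℕ k
  tail-column i j tail = toℕ-injective (trans
    (ℕ.≤-antisym (s≤s⁻¹ (toℕ<n j)) (s≤s⁻¹ K≤1+j)) (sym (toℕ-fromℕ k)))
    where
    K≤1+j : K ≤ suc (toℕ j)
    K≤1+j = ∣⇒≤ (∣m+n∣m⇒∣n
      (subst (K ∣_) (trans (cong suc (toℕ-combine i j)) (sym (ℕ.+-suc (K * toℕ i) (toℕ j)))) tail)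
      (m∣m*n (toℕ i)))

  -- All tails lie in the last column, so the row determines a tail.
  quotient-tail-injective : ∀ {x y : Fin N} → Tail K (toℕ x) → Tail K (toℕ y) →
    quotient {suc q} K x ≡ quotient K y → x ≡ y
  quotient-tail-injective {x} {y} tx ty eq = begin
    x
      ≡⟨ combine-remQuot {suc q} K x ⟨
    combine (quotient {suc q} K x) (remainder {suc q} K x)
      ≡⟨ cong₂ combine eq (trans (last x tx) (sym (last y ty))) ⟩
    combine (quotient {suc q} K y) (remainder {suc q} K y)
      ≡⟨ combine-remQuot {suc q} K y ⟩
    y ∎
    where
    open ≡-Reasoning

    last : ∀ z → Tail K (toℕ z) → remainder {suc q} K z ≡ fromℕ k
    last z tz = tail-column (quotient K z) (remainder {suc q} K z)
      (subst (Tail K ∘ toℕ) (sym (combine-remQuot {suc q} K z)) tz)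

  headAt : Fin q → Fin N
  headAt s = combine (suc s) zero

  toℕ-headAt : ∀ s → toℕ (headAt s) ≡ K * suc (toℕ s)
  toℕ-headAt s = trans (toℕ-combine (suc s) (zero {k})) (ℕ.+-identityʳ _)

  headAt-head : ∀ s → Head K (toℕ (headAt s))
  headAt-head s rewrite toℕ-headAt s = (λ ()) , m∣m*n (suc (toℕ s))

  headAt-injective : Injective _≡_ _≡_ headAt
  headAt-injective {s} {s′} eq = suc-injective (combine-injectiveˡ (suc s) zero (suc s′) zero eq)

  headAt-surjective : ∀ p → Head K (toℕ p) → ∃ λ s → headAt s ≡ p
  headAt-surjective p (p≢0 , K∣p) with combine-surjective {suc q} {K} p
  ... | zero  , zero  , refl = contradiction refl p≢0
  ... | suc s , zero  , refl = s , refl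
  ... | i     , suc j , refl = contradiction
    (∣⇒≤ (∣m+n∣m⇒∣n (subst (K ∣_) (toℕ-combine i (suc j)) K∣p) (m∣m*n (toℕ i))))
    (ℕ.<⇒≱ (s<s (toℕ<n j)))

  SameColours : (R P : HamiltonPath N) → Set
  SameColours R P = ∀ v → colour K (toℕ (P ⟨$⟩ˡ v)) ≡ colour K (toℕ (R ⟨$⟩ˡ v))

  module _ (R : HamiltonPath N) where

    -- The head and tail vertices are numbered by their rows in the reference path R.
    link : HamiltonPath N → Fin q → Fin (suc q)
    link P s = quotient K (R ⟨$⟩ˡ (P ⟨$⟩ʳ pred (P ⟨$⟩ˡ (R ⟨$⟩ʳ headAt s))))

    module _ {P : HamiltonPath N} (same : SameColours R P) where

      head-position : ∀ s → Head K (toℕ (P ⟨$⟩ˡ (R ⟨$⟩ʳ headAt s)))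
      head-position s = colour-head K
        (trans (cong (colour K ∘ toℕ) (sym (inverseˡ R))) (sym (same (R ⟨$⟩ʳ headAt s)))) (headAt-head s)

      tail-position : ∀ p → Tail K (toℕ p) → Tail K (toℕ (R ⟨$⟩ˡ (P ⟨$⟩ʳ p)))
      tail-position p = colour-tail K
        (trans (cong (colour K ∘ toℕ) (sym (inverseˡ P))) (same (P ⟨$⟩ʳ p)))

      link-tail : ∀ s → Tail K (toℕ (R ⟨$⟩ˡ (P ⟨$⟩ʳ pred (P ⟨$⟩ˡ (R ⟨$⟩ʳ headAt s)))))
      link-tail s = tail-position _ (pred-tail (P ⟨$⟩ˡ (R ⟨$⟩ʳ headAt s)) (head-position s))

    -- The vertices before the heads are tails in `P` and in `Q`, hence by colour also in `R`, where
    -- the row number recorded by `link` identifies them.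
    link-cancel : ∀ {P Q} (P-same : SameColours R P) (Q-same : SameColours R Q) {s s′} →
      link P s ≡ link Q s′ →
      P ⟨$⟩ʳ pred (P ⟨$⟩ˡ (R ⟨$⟩ʳ headAt s)) ≡ Q ⟨$⟩ʳ pred (Q ⟨$⟩ˡ (R ⟨$⟩ʳ headAt s′))
    link-cancel {P} {Q} P-same Q-same {s} {s′} eq =
      Injection.injective (↔⇒↣ (Perm.flip R))
        (quotient-tail-injective (link-tail {P} P-same s) (link-tail {Q} Q-same s′) eq)

    link-injective : ∀ {P} → SameColours R P → Injective _≡_ _≡_ (link P)
    link-injective {P} same {s} {s′} eq = headAt-injective (Injection.injective (↔⇒↣ R)
      (Injection.injective (↔⇒↣ (Perm.flip P)) (toℕ-injective (begin
        toℕ p               ≡⟨ suc-pred p (proj₁ (head-position {P} same s)) ⟨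
        suc (toℕ (pred p))  ≡⟨ cong (suc ∘ toℕ) pred-p≡pred-p′ ⟩
        suc (toℕ (pred p′)) ≡⟨ suc-pred p′ (proj₁ (head-position {P} same s′)) ⟩
        toℕ p′              ∎))))
      where
      open ≡-Reasoning
      p  = P ⟨$⟩ˡ (R ⟨$⟩ʳ headAt s)
      p′ = P ⟨$⟩ˡ (R ⟨$⟩ʳ headAt s′)

      pred-p≡pred-p′ : pred p ≡ pred p′
      pred-p≡pred-p′ = Injection.injective (↔⇒↣ P) (link-cancel {P} {P} same same eq)

    -- By colour, a head vertex of `P` is also one of `R`, so it has a number s there; equal links
    -- at s give it the same predecessor in `P` and `Q`.
    link-linked : ∀ {P Q} → SameColours R P → SameColours R Q → link P ≗ link Q → Linked K P Q
    link-linked {P} {Q} P-same Q-same eq p head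
      with headAt-surjective (R ⟨$⟩ˡ (P ⟨$⟩ʳ p))
             (colour-head K (trans (cong (colour K ∘ toℕ) (sym (inverseˡ P))) (P-same (P ⟨$⟩ʳ p))) head)
    ... | s , Rs = subst (λ v → Q ⟨$⟩ʳ pred (Q ⟨$⟩ˡ v) ≡ P ⟨$⟩ʳ pred p) v≡ joined
                 , subst (λ v → Head K (toℕ (Q ⟨$⟩ˡ v))) v≡ (head-position {Q} Q-same s)
      where
      v≡ : R ⟨$⟩ʳ headAt s ≡ P ⟨$⟩ʳ p
      v≡ = trans (cong (R ⟨$⟩ʳ_) Rs) (inverseʳ R)

      joined : Q ⟨$⟩ʳ pred (Q ⟨$⟩ˡ (R ⟨$⟩ʳ headAt s)) ≡ P ⟨$⟩ʳ pred p
      joined = trans (sym (link-cancel {P} {Q} P-same Q-same (eq s)))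
        (cong (λ p → P ⟨$⟩ʳ pred p) (trans (cong (P ⟨$⟩ˡ_) v≡) (inverseˡ P)))

-- Pigeonhole relative to a representative of each colour class

-- A choice of representative in the fibre over `y`; the default `junk` is returned only if the
-- fibre is empty.
preimage : (f : Fin m → Fin n) → Fin n → Fin m → Fin m
preimage f y junk with any? (λ i → f i ≟ y)
... | yes (i , _) = i
... | no _        = junk

preimage-image : ∀ (f : Fin m → Fin n) i junk → f (preimage f (f i) junk) ≡ f i
preimage-image f i junk with any? (λ j → f j ≟ f i)
... | yes (_ , eq) = eq
... | no ¬∃        = contradiction (i , refl) ¬∃

preimage-junk : ∀ (f : Fin m → Fin n) i junk junk′ → preimage f (f i) junk ≡ preimage f (f i) junk′
preimage-junk f i junk junk′ with any? (λ j → f j ≟ f i)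
... | yes _ = refl
... | no ¬∃ = contradiction (i , refl) ¬∃

-- The injection `f r i` makes sense only against a reference `r` with the same colouring. Each
-- colour class supplies one representative as reference, and a member is coded by its class
-- together with the rank of its injection.
double-pigeonhole : ∀ {c} (χ : Fin m → Fin n → Fin c) (f : Fin m → Fin m → Fin a → Fin b) →
  (∀ r i → χ r ≗ χ i → Injective _≡_ _≡_ (f r i)) → c ^ n * b ! < m →
  ∃₂ λ i j → i ≢ j × ∃ λ r → χ r ≗ χ i × χ r ≗ χ j × f r i ≗ f r j
double-pigeonhole {m} {n} {a} {b} {c} χ f f-inj large =
  let i , j , i<j , eq = pigeonhole large code
      c≡ , r≡ = combine-injective (class i) (rank (inj i)) (class j) (rank (inj j)) eq
      -- Members of one class get the same representative: their fibre is nonempty, so the differing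
      -- defaults `i` and `j` do not matter.
      rep≡ = trans (preimage-junk class j j i) (cong (λ y → preimage class y i) (sym c≡))
  in i , j , <⇒≢ i<j , rep i , same i
     , subst (λ r → χ r ≗ χ j) rep≡ (same j)
     , λ s → trans (rank-injective (inj i) (inj j) r≡ s) (cong (λ r → f r j s) rep≡)
  where
  class : Fin m → Fin (c ^ n)
  class i = funToFin (χ i)

  class-χ : ∀ i j → class i ≡ class j → χ i ≗ χ j
  class-χ i j eq v = trans (sym (finToFun-funToFin (χ i) v))
    (trans (cong (λ y → finToFun y v) eq) (finToFun-funToFin (χ j) v))

  rep : Fin m → Fin m
  rep i = preimage class (class i) i

  same : ∀ i → χ (rep i) ≗ χ i
  same i = class-χ (rep i) i (preimage-image class i i)

  inj : ∀ i → Injective _≡_ _≡_ (f (rep i) i)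
  inj i = f-inj (rep i) i (same i)

  code : Fin m → Fin (c ^ n * b !)
  code i = combine (class i) (rank (inj i))

-- In a larger family two members would have equal colours and equal links relative to a common
-- reference. Each would then be linked to the other, so neither could have a subpath with k edges
-- disjoint from the other.
upper-bound : .{{_ : NonZero k}} → ∀ q → Family (suc q * k) k m → m ≤ 3 ^ (suc q * k) * (suc q) !
upper-bound {suc k} {m} q F = ℕ.≮⇒≥ λ large →
  let i , j , i≢j , r , r≗i , r≗j , fi≗fj = double-pigeonhole colours links links-injective large
  in contradiction (separated i j i≢j)
    [ linked⇒¬disjoint (path i) (path j)
        (link-linked {q} {k} (path r) {path i} {path j} (sym ∘ r≗i) (sym ∘ r≗j) fi≗fj)
    , linked⇒¬disjoint (path j) (path i)
        (link-linked {q} {k} (path r) {path j} {path i} (sym ∘ r≗j) (sym ∘ r≗i) (sym ∘ fi≗fj)) ]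
  where
  open Family F

  colours : Fin m → Fin (suc q * suc k) → Fin 3
  colours i v = colour (suc k) (toℕ (path i ⟨$⟩ˡ v))

  links : Fin m → Fin m → Fin q → Fin (suc q)
  links r i = link {q} {k} (path r) (path i)

  links-injective : ∀ r i → colours r ≗ colours i → Injective _≡_ _≡_ (links r i)
  links-injective r i r≗i = link-injective {q} {k} (path r) {path i} (sym ∘ r≗i)

-- The two bounds on M(n,k)

theorem3 : ∀ (n k : ℕ) .{{_ : NonZero n}} .{{_ : NonZero k}} → k % 2 ≡ 1 → k ∣ n →
    ∃[ M ] (IsMaximumSize n k M × (n / k ∸ 1) ! ≤ M × M ≤ 3 ^ n * (n / k) !)
theorem3 n k odd (divides zero n≡0) = contradiction n≡0 (≢-nonZero⁻¹ n)
theorem3 n k odd (divides (suc q) n≡qk) =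
  M , (F , max)
    , subst (λ r → (r ∸ 1) ! ≤ M) (sym n/k≡1+q) (max (q !) lower)
    , subst (λ r → M ≤ 3 ^ n * r !) (sym n/k≡1+q) (upper M F)
  where
  n/k≡1+q : n / k ≡ suc q
  n/k≡1+q = trans (cong (_/ k) n≡qk) (m*n/n≡m (suc q) k)

  lower : Family n k (q !)
  lower = subst (λ n → Family n k (q !)) (sym n≡qk) (lower-bound odd q)

  upper : ∀ m → Family n k m → m ≤ 3 ^ n * (suc q) !
  upper m F = subst (λ n → m ≤ 3 ^ n * (suc q) !) (sym n≡qk)
    (upper-bound q (subst (λ n → Family n k m) n≡qk F))

  largest : ∃ λ M → Family n k M × (∀ m → Family n k m → m ≤ M)
  -- The search for the maximum starts at the upper bound and has the empty family to fall back on.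
  largest = maximum (family? n k) (separated⇒family (λ ()) λ ()) (3 ^ n * (suc q) !) upper

  M   = proj₁ largest
  F   = proj₁ (proj₂ largest)
  max = proj₂ (proj₂ largest)
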